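{- Let $n$ be an even positive integer, let $T$ be an even plane tree with $n$ vertices and let $U$ be an odd plane tree with $n$ vertices. Then the rotation groups of $T$ and $U$ are different: for any choice of bipartite structures on $T$ and $U$ and any enumerations of their edges by $1,\dots,n-1$, the subgroups $R(T)$ and $R(U)$ of $S_{n-1}$ do not coincide.
   Context: A plane tree is a finite tree embedded in the plane (equivalently, a tree with a cyclic counterclockwise order on the edges at each vertex). Parity: a pr-tree (plane rooted tree) is obtained from a plane tree by choosing a root vertex and a marked edge incident to the root. The children of each vertex are ordered from left to right: at the root, the edges are taken in counterclockwise order starting from the marked edge, and at any other vertex the edges to children are taken in counterclockwise order starting just after the edge to the parent. The bracket code of a pr-tree whose root has pr-subtrees $T_1,\dots,T_s$ (left to right) is recursively $(\,c(T_1)\cdots c(T_s)\,)$, where $c(T_i)$ is the code of $T_i$, and the one-vertex tree has code $()$. An inversion in a bracket code is a pair consisting of a closing bracket and an opening bracket, not necessarily adjacent, such that the closing bracket occurs before the opening bracket. A pr-tree is even if the number of inversions in its bracket code is even, and odd otherwise. For a plane tree with an even number of vertices this parity does not depend on the choice of root vertex and marked edge, so one speaks of even and odd plane trees. Rotation group: a bipartite structure on a tree is a coloring of its vertices in black and white such that adjacent vertices have different colors (there are two of them). Let $T$ be a plane bipartite tree with $m$ edges enumerated by $M=\{1,\dots,m\}$. The permutation $s_w:M\to M$ is defined by $s_w(i)=j$ if the $i$-th and $j$-th edges are incident to the same white vertex $v$ and the $j$-th edge is the next after the $i$-th edge in going counterclockwise around $v$ (so $s_w(i)=i$ if $v$ has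 degree 1). The permutation $s_b$ is defined in the same way with respect to black vertices. The rotation group is $R(T)=\langle s_w,s_b\rangle\subset S_m$. Different enumerations of the edges give conjugate rotation groups. -}

module Defs where

open import Data.Fin using (Fin)
open import Data.Fin.Permutation as Perm using (Permutation′; _∘ₚ_; flip)
open import Data.Irrelevant using ([_])
open import Data.List using (List; []; _∷_; _++_; _∷ʳ_; length; filter; allFin; iterate; drop)
open import Data.List.Relation.Binary.Pointwise using (Pointwise)
open import Data.List.Relation.Unary.Linked using (Linked)
open import Data.List.Relation.Unary.Unique.Propositional using (Unique)
open import Data.Nat using (ℕ; _+_; _≤_)
open import Data.Nat.Divisibility using (_∣_)
open import Data.Nat.GeneralisedArithmetic using (fold)
open import Data.Product using (_×_; _,_; proj₁; proj₂; ∃-syntax)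
open import Data.Refinement using (Refinement; _,_; value)
open import Function.Bundles using (_↔_; module Inverse; mk↔ₛ′)
open import Function.Construct.Composition using (_↔-∘_)
open import Function.Construct.Symmetry using (↔-sym)
open import Level using (0ℓ)
open import Relation.Binary.Construct.Closure.ReflexiveTransitive using (Star)
open import Relation.Binary.Core using (Rel)
open import Relation.Binary.Definitions using (Decidable; Irreflexive; Symmetric)
open import Relation.Binary.PropositionalEquality using (_≡_; _≢_; refl; sym; trans; cong)
open import Relation.Nullary using (¬_; contradiction)
open import Relation.Unary using (Pred)

open Inverse using (to; from; strictlyInverseˡ; strictlyInverseʳ)

record Tree (n : ℕ) : Set₁ where
  field
    Adj       : Rel (Fin n) 0ℓ
    Adj?      : Decidable Adj
    irrefl    : Irreflexive _≡_ Adj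
    symmetric : Symmetric Adj
    connected : ∀ u v → Star Adj u v
    acyclic   : ∀ x ys → 2 ≤ length ys → Unique (x ∷ ys) → ¬ Linked Adj (x ∷ ys ∷ʳ x)

  -- The graph is simple, so an edge at v is recorded by its other endpoint.
  -- Adjacency proofs are irrelevant here, so that _≡_ on Neighbour v is
  -- equality of endpoints.
  Neighbour : Fin n → Set
  Neighbour v = Refinement (Fin n) (Adj v)

  back : ∀ {v} (u : Neighbour v) → Neighbour (value u)
  back {v} (u , [ v~u ]) = v , [ symmetric v~u ]

  degree : Fin n → ℕ
  degree v = length (filter (Adj? v) (allFin n))

-- rotation v sends each edge at v to the next one counterclockwise; that it is
-- a single cycle is expressed by transitivity.
record PlaneTree (n : ℕ) : Set₁ where
  field
    tree : Tree n
  open Tree tree public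
  field
    rotation : ∀ v → Neighbour v ↔ Neighbour v
    cyclic   : ∀ v (a b : Neighbour v) → ∃[ k ] fold a (to (rotation v)) k ≡ b

  next prev : ∀ v → Neighbour v → Neighbour v
  next v = to (rotation v)
  prev v = from (rotation v)

  -- All edges at v, each once, counterclockwise from the given one.
  edgesFrom : ∀ {v} → Neighbour v → List (Neighbour v)
  edgesFrom {v} a = iterate (next v) a (degree v)

data PRTree : Set where
  node : List PRTree → PRTree

data Bracket : Set where
  opening closing : Bracket

code  : PRTree → List Bracket
codes : List PRTree → List Bracket

code (node ts) = opening ∷ codes ts ++ closing ∷ []

codes []       = []
codes (t ∷ ts) = code t ++ codes ts

openings : List Bracket → ℕ
openings []             = 0
openings (opening ∷ bs) = 1 + openings bs
openings (closing ∷ bs) = openings bs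

inversions : List Bracket → ℕ
inversions []             = 0
inversions (opening ∷ bs) = inversions bs
inversions (closing ∷ bs) = openings bs + inversions bs

EvenPR OddPR : PRTree → Set
EvenPR t = 2 ∣ inversions (code t)
OddPR  t = ¬ EvenPR t

module _ {n : ℕ} (T : PlaneTree n) where
  open PlaneTree T

  -- SubtreeAt c t: t is the pr-subtree hanging from the child c of v.  The edges
  -- at c, listed counterclockwise from the one to the parent v, have that edge
  -- as their first entry; the remaining ones lead to the children of c.
  data SubtreeAt {v : Fin n} (c : Neighbour v) : PRTree → Set where
    node : ∀ {ts} → Pointwise SubtreeAt (drop 1 (edgesFrom (back c))) ts →
           SubtreeAt c (node ts)

  -- t is the pr-tree obtained from T by choosing the root and the marked edge.
  data RootedAt (root : Fin n) (marked : Neighbour root) : PRTree → Set where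
    node : ∀ {ts} → Pointwise SubtreeAt (edgesFrom marked) ts →
           RootedAt root marked (node ts)

  -- For even n the parity is the same for every root and marked edge; requiring
  -- it for some choice makes these the weakest possible hypotheses.
  EvenPlane OddPlane : Set
  EvenPlane = ∃[ root ] ∃[ marked ] ∃[ t ] RootedAt root marked t × EvenPR t
  OddPlane  = ∃[ root ] ∃[ marked ] ∃[ t ] RootedAt root marked t × OddPR t

data Colour : Set where
  black white : Colour

record BipartiteStructure {n : ℕ} (T : PlaneTree n) : Set where
  open PlaneTree T
  field
    colour : Fin n → Colour
    proper : ∀ {u v} → Adj u v → colour u ≢ colour v

  IsEdge : Fin n × Fin n → Set
  IsEdge (w , b) = colour w ≡ white × colour b ≡ black × Adj w b

  -- Edges as pairs (white endpoint , black endpoint).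
  Edge : Set
  Edge = Refinement (Fin n × Fin n) IsEdge

  private
    opposite-black : ∀ {u v} → Adj u v → colour u ≡ black → colour v ≡ white
    opposite-black {v = v} a p with colour v in q
    ... | white = refl
    ... | black = contradiction (trans p (sym q)) (proper a)

    opposite-white : ∀ {u v} → Adj u v → colour u ≡ white → colour v ≡ black
    opposite-white {v = v} a p with colour v in q
    ... | black = refl
    ... | white = contradiction (trans p (sym q)) (proper a)

  edgeAtWhite : ∀ w → .(colour w ≡ white) → Neighbour w → Edge
  edgeAtWhite w p (b , [ a ]) = (w , b) , [ (p , opposite-white a p , a) ]

  edgeAtBlack : ∀ b → .(colour b ≡ black) → Neighbour b → Edge
  edgeAtBlack b p (w , [ a ]) = (w , b) , [ (opposite-black a p , p , symmetric a) ]

  turnAtWhite turnAtBlack : (∀ v → Neighbour v → Neighbour v) → Edge → Edge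
  turnAtWhite f ((w , b) , [ e ]) =
    edgeAtWhite w (proj₁ e) (f w (b , [ proj₂ (proj₂ e) ]))
  turnAtBlack f ((w , b) , [ e ]) =
    edgeAtBlack b (proj₁ (proj₂ e)) (f b (w , [ symmetric (proj₂ (proj₂ e)) ]))

  rotateAtWhite rotateAtBlack : Edge ↔ Edge
  rotateAtWhite = mk↔ₛ′ (turnAtWhite next) (turnAtWhite prev)
    (λ { ((w , b) , [ e ]) → cong (edgeAtWhite w (proj₁ e)) (strictlyInverseˡ (rotation w) _) })
    (λ { ((w , b) , [ e ]) → cong (edgeAtWhite w (proj₁ e)) (strictlyInverseʳ (rotation w) _) })
  rotateAtBlack = mk↔ₛ′ (turnAtBlack next) (turnAtBlack prev)
    (λ { ((w , b) , [ e ]) → cong (edgeAtBlack b (proj₁ (proj₂ e))) (strictlyInverseˡ (rotation b) _) })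
    (λ { ((w , b) , [ e ]) → cong (edgeAtBlack b (proj₁ (proj₂ e))) (strictlyInverseʳ (rotation b) _) })

  Enumeration : ℕ → Set
  Enumeration m = Fin m ↔ Edge

  s-w s-b : ∀ {m} → Enumeration m → Permutation′ m
  s-w e = ↔-sym e ↔-∘ (rotateAtWhite ↔-∘ e)
  s-b e = ↔-sym e ↔-∘ (rotateAtBlack ↔-∘ e)

-- The subgroup of S_m generated by σ and τ.  The last constructor closes it
-- under equality of permutations as functions, which is not _≡_.
data ⟨_,_⟩ {m : ℕ} (σ τ : Permutation′ m) : Pred (Permutation′ m) 0ℓ where
  fst  : ⟨ σ , τ ⟩ σ
  snd  : ⟨ σ , τ ⟩ τ
  unit : ⟨ σ , τ ⟩ Perm.id
  comp : ∀ {π ρ} → ⟨ σ , τ ⟩ π → ⟨ σ , τ ⟩ ρ → ⟨ σ , τ ⟩ (π ∘ₚ ρ)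
  inv  : ∀ {π} → ⟨ σ , τ ⟩ π → ⟨ σ , τ ⟩ (flip π)
  resp : ∀ {π ρ} → π Perm.≈ ρ → ⟨ σ , τ ⟩ π → ⟨ σ , τ ⟩ ρ

RotationGroup : ∀ {n m} {T : PlaneTree n} (B : BipartiteStructure T) →
                BipartiteStructure.Enumeration B m → Pred (Permutation′ m) 0ℓ
RotationGroup B e = ⟨ s-w e , s-b e ⟩
  where open BipartiteStructure B

{-# OPTIONS --safe #-}
module Submission where

-- Multiplying by transpositions shows that a permutation of m elements with c
-- orbits has the sign (-1)^(m - c).  The orbits of s_w and of s_b are the white
-- and the black vertices, and their numbers have the same parity since n is
-- even.  On the bracket side, the i-th opening bracket is preceded by i minus
-- (depth of its vertex) closing ones, so the number of inversions is congruent
-- to n (n - 1) / 2 plus the number of vertices at odd depth, which form one of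
-- the two colour classes.  Hence the parity of a plane tree with n vertices
-- determines the common sign of s_w and s_b: for T and U of different parity
-- exactly one of the two rotation groups consists of even permutations.

import Algebra.Properties.CommutativeMonoid.Sum
open import Data.Bool using (Bool; true; false; not; if_then_else_; _xor_)
open import Data.Bool.Properties using (xor-same)
open import Data.Fin using (Fin; zero; suc; toℕ; _≟_)
open import Data.Fin.Patterns using (0F)
open import Data.Fin.Permutation as Perm
  using (Permutation′; _⟨$⟩ʳ_; _∘ₚ_; flip; lift₀; swap; transpose; remove)
open import Data.Fin.Properties using (toℕ-injective; suc-injective)
open import Data.Irrelevant using ([_])
open import Data.List
  using (List; []; _∷_; _++_; _∷ʳ_; length; filter; allFin; iterate; drop; map)
import Data.List.Membership.DecPropositional as DecMembership
open import Data.List.Membership.Propositional using (_∈_; _∉_)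
open import Data.List.Membership.Propositional.Properties
  using (∈-∃++; ∈-allFin; ∈-filter⁺; ∈-filter⁻; ∈-map⁺; ∈-map⁻; ∈-++⁺ˡ; ∈-++⁺ʳ; ∈-++⁻)
open import Data.List.Properties
  using (filter-accept; filter-reject; filter-++; length-++; length-iterate; length-map; length-tabulate)
open import Data.List.Relation.Binary.Disjoint.Propositional using (Disjoint)
open import Data.List.Relation.Binary.Permutation.Propositional using (_↭_; ↭-sym; ↭⇒↭ₛ)
open import Data.List.Relation.Binary.Permutation.Propositional.Properties
  using (shift; ∈-resp-↭; ↭-length)
import Data.List.Relation.Binary.Permutation.Setoid.Properties as ↭ₛ
open import Data.List.Relation.Binary.Pointwise using (Pointwise; []; _∷_)
open import Data.List.Relation.Binary.Subset.Propositional using (_⊆_)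
open import Data.List.Relation.Unary.All as All using (All; []; _∷_)
open import Data.List.Relation.Unary.All.Properties using (¬Any⇒All¬; ++⁻ˡ; ++⁻ʳ)
open import Data.List.Relation.Unary.AllPairs using ([]; _∷_)
open import Data.List.Relation.Unary.Any using (here; there)
open import Data.List.Relation.Unary.Linked using (Linked; [-]; _∷_)
import Data.List.Relation.Unary.Unique.DecPropositional as DecUnique
open import Data.List.Relation.Unary.Unique.Propositional using (Unique)
import Data.List.Relation.Unary.Unique.Propositional.Properties as Unique
open import Data.Nat
  using (ℕ; zero; suc; _+_; _*_; _∸_; _≤_; _<_; _<ᵇ_; z≤n; s≤s; parity)
open import Data.Nat.Divisibility using (_∣_; divides)
open import Data.Nat.GeneralisedArithmetic using (fold)
open import Data.Nat.Properties
  using (+-0-commutativeMonoid; +-identityʳ; +-suc; *-cancelˡ-≡; ≤-trans; ≤-reflexive;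
         ≤-antisym; n≮n; <⇒≱; m≤n⇒m≤1+n)
open import Data.Nat.Tactic.RingSolver using (solve-∀)
open import Data.Parity as ℙ using (Parity; 0ℙ; 1ℙ)
import Data.Parity.Properties as ℙ
open import Data.Product using (_×_; _,_; ∃-syntax; proj₁; proj₂)
open import Data.Refinement using (value; value-injective; _,_)
import Data.Refinement as Refinement
open import Data.Sum using (_⊎_; inj₁; inj₂)
open import Function using (_∘_; id)
open import Function.Bundles using (_↔_; module Inverse; Injection)
open import Function.Construct.Composition using (_↔-∘_)
open import Function.Construct.Symmetry using (↔-sym)
open import Function.Properties.Inverse using (↔⇒↣)
open import Relation.Binary.Construct.Closure.ReflexiveTransitive
  using (Star; ε; _◅_; _◅◅_; gmap)
open import Relation.Binary.Definitions using (DecidableEquality)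
open import Relation.Binary.PropositionalEquality
open import Relation.Nullary using (¬_; yes; no; contradiction)
open import Relation.Nullary.Decidable using (dec-true; dec-false; decidable-stable; recompute)
open import Relation.Unary using (_≐_)
open import Defs

open Algebra.Properties.CommutativeMonoid.Sum +-0-commutativeMonoid
  using (sum; ∑-comm; ∑-distrib-+; sum-cong-≗; sum-permute; sum-replicate-zero)

private variable
  m : ℕ
  A : Set

-- The sign of a permutation

parity-∑ : (f g : Fin m → ℕ) → (∀ i → parity (f i) ≡ parity (g i)) →
           parity (sum f) ≡ parity (sum g)
parity-∑ {zero}  f g f≡g = refl
parity-∑ {suc m} f g f≡g = begin
  parity (f 0F + sum (f ∘ suc))             ≡⟨ ℙ.+-homo-+ (f 0F) _ ⟩
  parity (f 0F) ℙ.+ parity (sum (f ∘ suc))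
    ≡⟨ cong₂ ℙ._+_ (f≡g 0F) (parity-∑ (f ∘ suc) (g ∘ suc) (f≡g ∘ suc)) ⟩
  parity (g 0F) ℙ.+ parity (sum (g ∘ suc))  ≡⟨ ℙ.+-homo-+ (g 0F) _ ⟨
  parity (g 0F + sum (g ∘ suc))             ∎
  where open ≡-Reasoning

_<ᶠ_ : Fin m → Fin m → Bool
i <ᶠ j = toℕ i <ᵇ toℕ j

when : Bool → ℕ → ℕ
when b k = if b then k else 0

∑∑ ∑< : (Fin m → Fin m → ℕ) → ℕ
∑∑ g = sum (λ i → sum (λ j → g i j))
∑< g = ∑∑ (λ i j → when (i <ᶠ j) (g i j))

∑∑-cong : {g h : Fin m → Fin m → ℕ} → (∀ i j → g i j ≡ h i j) → ∑∑ g ≡ ∑∑ h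
∑∑-cong g≡h = sum-cong-≗ (λ i → sum-cong-≗ (g≡h i))

∑∑-+ : (g h : Fin m → Fin m → ℕ) → ∑∑ (λ i j → g i j + h i j) ≡ ∑∑ g + ∑∑ h
∑∑-+ g h = trans (sum-cong-≗ (λ i → ∑-distrib-+ (g i) (h i)))
                 (∑-distrib-+ (λ i → sum (g i)) (λ i → sum (h i)))

when-+ : ∀ b k l → when b (k + l) ≡ when b k + when b l
when-+ true  k l = refl
when-+ false k l = refl

∑<-+ : (g h : Fin m → Fin m → ℕ) → ∑< (λ i j → g i j + h i j) ≡ ∑< g + ∑< h
∑<-+ g h = trans (∑∑-cong (λ i j → when-+ (i <ᶠ j) (g i j) (h i j)))
                 (∑∑-+ (λ i j → when (i <ᶠ j) (g i j)) (λ i j → when (i <ᶠ j) (h i j)))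

∑<-cong : {g h : Fin m → Fin m → ℕ} → (∀ i j → g i j ≡ h i j) → ∑< g ≡ ∑< h
∑<-cong g≡h = ∑∑-cong (λ i j → cong (when (i <ᶠ j)) (g≡h i j))

parity-∑< : (g h : Fin m → Fin m → ℕ) → (∀ i j → parity (g i j) ≡ parity (h i j)) →
            parity (∑< g) ≡ parity (∑< h)
parity-∑< g h g≡h = parity-∑ _ _ λ i → parity-∑ _ _ λ j → lemma (i <ᶠ j) (g≡h i j)
  where
  lemma : ∀ b {k l} → parity k ≡ parity l → parity (when b k) ≡ parity (when b l)
  lemma true  k≡l = k≡l
  lemma false k≡l = refl

<ᵇ-trichotomy : ∀ a b → a ≢ b → ∀ k → when (a <ᵇ b) k + when (b <ᵇ a) k ≡ k
<ᵇ-trichotomy zero    zero    a≢b k = contradiction refl a≢b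
<ᵇ-trichotomy zero    (suc b) a≢b k = +-identityʳ k
<ᵇ-trichotomy (suc a) zero    a≢b k = refl
<ᵇ-trichotomy (suc a) (suc b) a≢b k = <ᵇ-trichotomy a b (a≢b ∘ cong suc) k

when-0 : ∀ b → when b 0 ≡ 0
when-0 true  = refl
when-0 false = refl

-- Renaming the indices turns the second copy into the sum over `j < i`. For `i ≢ j` exactly one of
-- the two conditions holds, and the diagonal contributes nothing.
2∑< : (g : Fin m → Fin m → ℕ) → (∀ i j → g i j ≡ g j i) → (∀ i → g i i ≡ 0) →
      ∑< g + ∑< g ≡ ∑∑ g
2∑< g symm diag = begin
  ∑< g + ∑< g
    ≡⟨ cong (∑< g +_) (∑-comm (λ i j → when (i <ᶠ j) (g i j))) ⟩
  ∑< g + ∑∑ (λ i j → when (j <ᶠ i) (g j i))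
    ≡⟨ ∑∑-+ (λ i j → when (i <ᶠ j) (g i j)) (λ i j → when (j <ᶠ i) (g j i)) ⟨
  ∑∑ (λ i j → when (i <ᶠ j) (g i j) + when (j <ᶠ i) (g j i))
    ≡⟨ ∑∑-cong pointwise ⟩
  ∑∑ g ∎
  where
  open ≡-Reasoning
  pointwise : ∀ i j → when (i <ᶠ j) (g i j) + when (j <ᶠ i) (g j i) ≡ g i j
  pointwise i j with i ≟ j
  ... | yes refl rewrite diag i = cong₂ _+_ (when-0 (i <ᶠ i)) (when-0 (i <ᶠ i))
  ... | no  i≢j  rewrite symm j i = <ᵇ-trichotomy _ _ (i≢j ∘ toℕ-injective) _

+-diag-injective : ∀ {k l} → k + k ≡ l + l → k ≡ l
+-diag-injective {k} {l} eq = *-cancelˡ-≡ k l 2 (begin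
  k + (k + 0)  ≡⟨ cong (k +_) (+-identityʳ k) ⟩
  k + k        ≡⟨ eq ⟩
  l + l        ≡⟨ cong (l +_) (+-identityʳ l) ⟨
  l + (l + 0)  ∎)
  where open ≡-Reasoning

-- A sum over the pairs i < j is half of the sum over all ordered pairs, which is
-- visibly invariant under σ.
∑<-permute : (σ : Permutation′ m) (g : Fin m → Fin m → ℕ) →
             (∀ i j → g i j ≡ g j i) → (∀ i → g i i ≡ 0) →
             ∑< (λ i j → g (σ ⟨$⟩ʳ i) (σ ⟨$⟩ʳ j)) ≡ ∑< g
∑<-permute σ g symm diag = +-diag-injective (begin
  ∑< gσ + ∑< gσ  ≡⟨ 2∑< gσ (λ i j → symm _ _) (λ i → diag _) ⟩
  ∑∑ gσ          ≡⟨ sum-cong-≗ (λ i → sum-permute (g (σ ⟨$⟩ʳ i)) σ) ⟨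
  sum (λ i → sum (g (σ ⟨$⟩ʳ i)))  ≡⟨ sum-permute (λ i → sum (g i)) σ ⟨
  ∑∑ g           ≡⟨ 2∑< g symm diag ⟨
  ∑< g + ∑< g    ∎)
  where
  open ≡-Reasoning
  gσ : Fin _ → Fin _ → ℕ
  gσ i j = g (σ ⟨$⟩ʳ i) (σ ⟨$⟩ʳ j)

-- True when `σ` inverts the pair. The exclusive or of two comparisons is symmetric in `i` and `j`,
-- as `∑<-permute` requires.
reverses : Permutation′ m → Fin m → Fin m → Bool
reverses σ i j = (i <ᶠ j) xor ((σ ⟨$⟩ʳ i) <ᶠ (σ ⟨$⟩ʳ j))

bit : Bool → ℕ
bit b = when b 1

-- The parity of the number of inverted pairs: the sign in additive notation, with `0ℙ` for even
-- permutations.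
sgn : Permutation′ m → Parity
sgn σ = parity (∑< (λ i j → bit (reverses σ i j)))

-- The middle comparison `b` occurs twice on the right and cancels modulo 2.
parity-bit-xor : ∀ a b c → parity (bit (a xor c)) ≡ parity (bit (a xor b) + bit (b xor c))
parity-bit-xor true  true  true  = refl
parity-bit-xor true  true  false = refl
parity-bit-xor true  false true  = refl
parity-bit-xor true  false false = refl
parity-bit-xor false true  true  = refl
parity-bit-xor false true  false = refl
parity-bit-xor false false true  = refl
parity-bit-xor false false false = refl

<ᵇ-flip : ∀ {a b} → a ≢ b → (b <ᵇ a) ≡ not (a <ᵇ b)
<ᵇ-flip {zero}  {zero}  a≢b = contradiction refl a≢b
<ᵇ-flip {zero}  {suc b} a≢b = refl
<ᵇ-flip {suc a} {zero}  a≢b = refl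
<ᵇ-flip {suc a} {suc b} a≢b = <ᵇ-flip (a≢b ∘ cong suc)

permutation-injective : (σ : Permutation′ m) → ∀ {i j} → σ ⟨$⟩ʳ i ≡ σ ⟨$⟩ʳ j → i ≡ j
permutation-injective σ = Injection.injective (↔⇒↣ σ)

-- Exchanging distinct `i` and `j` negates both comparisons, the second by injectivity of `σ`, and
-- two negations cancel in an exclusive or.
reverses-sym : (σ : Permutation′ m) → ∀ i j → reverses σ i j ≡ reverses σ j i
reverses-sym σ i j with i ≟ j
... | yes refl = refl
... | no  i≢j
  rewrite <ᵇ-flip {toℕ i} {toℕ j} (i≢j ∘ toℕ-injective)
        | <ᵇ-flip {toℕ (σ ⟨$⟩ʳ i)} {toℕ (σ ⟨$⟩ʳ j)} (i≢j ∘ permutation-injective σ ∘ toℕ-injective)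
  with i <ᶠ j | (σ ⟨$⟩ʳ i) <ᶠ (σ ⟨$⟩ʳ j)
... | true  | true  = refl
... | true  | false = refl
... | false | true  = refl
... | false | false = refl

<ᵇ-irrefl : ∀ a → (a <ᵇ a) ≡ false
<ᵇ-irrefl zero    = refl
<ᵇ-irrefl (suc a) = <ᵇ-irrefl a

reverses-irrefl : (σ : Permutation′ m) → ∀ i → reverses σ i i ≡ false
reverses-irrefl σ i rewrite <ᵇ-irrefl (toℕ i) = <ᵇ-irrefl (toℕ (σ ⟨$⟩ʳ i))

-- The composite applies `σ` first. It inverts a pair when exactly one of `σ`, on the pair, and `τ`,
-- on the image pair, does; `∑<-permute` then reindexes the sum over image pairs.
sgn-∘ : (σ τ : Permutation′ m) → sgn (σ ∘ₚ τ) ≡ sgn σ ℙ.+ sgn τ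
sgn-∘ σ τ = begin
  sgn (σ ∘ₚ τ)
    ≡⟨ parity-∑< _ (λ i j → bσ i j + bτ (σ ⟨$⟩ʳ i) (σ ⟨$⟩ʳ j))
        (λ i j → parity-bit-xor (i <ᶠ j) ((σ ⟨$⟩ʳ i) <ᶠ (σ ⟨$⟩ʳ j)) _) ⟩
  parity (∑< (λ i j → bσ i j + bτ (σ ⟨$⟩ʳ i) (σ ⟨$⟩ʳ j)))
    ≡⟨ cong parity (∑<-+ bσ _) ⟩
  parity (∑< bσ + ∑< (λ i j → bτ (σ ⟨$⟩ʳ i) (σ ⟨$⟩ʳ j)))
    ≡⟨ cong (λ k → parity (∑< bσ + k))
         (∑<-permute σ bτ (λ i j → cong bit (reverses-sym τ i j)) (λ i → cong bit (reverses-irrefl τ i))) ⟩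
  parity (∑< bσ + ∑< bτ)
    ≡⟨ ℙ.+-homo-+ (∑< bσ) (∑< bτ) ⟩
  sgn σ ℙ.+ sgn τ ∎
  where
  open ≡-Reasoning
  bσ bτ : Fin _ → Fin _ → ℕ
  bσ i j = bit (reverses σ i j)
  bτ i j = bit (reverses τ i j)

sgn-cong : (σ τ : Permutation′ m) → σ Perm.≈ τ → sgn σ ≡ sgn τ
sgn-cong σ τ σ≈τ = cong parity (∑<-cong λ i j →
  cong₂ (λ x y → bit ((i <ᶠ j) xor (x <ᶠ y))) (σ≈τ i) (σ≈τ j))

∑<-zero : (g : Fin m → Fin m → ℕ) → (∀ i j → g i j ≡ 0) → ∑< g ≡ 0
∑<-zero {m} g g≡0 = trans (∑∑-cong (λ i j → trans (cong (when (i <ᶠ j)) (g≡0 i j)) (when-0 (i <ᶠ j))))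
                          (trans (sum-cong-≗ {m} (λ _ → sum-replicate-zero m)) (sum-replicate-zero m))

sgn-id : sgn (Perm.id {m}) ≡ 0ℙ
sgn-id {m} = cong parity (∑<-zero {m} _ (λ i j → cong bit (xor-same (i <ᶠ j))))

sgn-flip : (σ : Permutation′ m) → sgn (flip σ) ≡ sgn σ
sgn-flip {m} σ = ℙ.+-cancelʳ-≡ (sgn σ) _ _ (begin
  sgn (flip σ) ℙ.+ sgn σ  ≡⟨ sgn-∘ (flip σ) σ ⟨
  sgn (flip σ ∘ₚ σ)       ≡⟨ sgn-cong (flip σ ∘ₚ σ) Perm.id (λ i → Perm.inverseʳ σ) ⟩
  sgn (Perm.id {m})       ≡⟨ sgn-id {m} ⟩
  0ℙ                      ≡⟨ ℙ.p+p≡0ℙ (sgn σ) ⟨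
  sgn σ ℙ.+ sgn σ         ∎)
  where open ≡-Reasoning

-- The fixed 0 stays below every other element, so no pair with 0 is inverted: row 0 is a sum of
-- zeros, and column 0 vanishes by computation.
sgn-lift₀ : (σ : Permutation′ m) → sgn (lift₀ σ) ≡ sgn σ
sgn-lift₀ {m} σ = cong (λ k → parity (k + sgnℕ)) (sum-replicate-zero m)
  where
  sgnℕ : ℕ
  sgnℕ = ∑< (λ i j → bit (reverses σ i j))

sgn-swap-id : sgn (swap (Perm.id {m})) ≡ 1ℙ
-- The `suc` counts the pair (0, 1), the only inverted one; the two `k` are the remainders of rows 0
-- and 1, and `l` is the sum of the other rows.
sgn-swap-id {m} = cong parity (cong₂ (λ k l → suc k + (k + l)) (sum-replicate-zero m)
  (∑<-zero {m} _ (λ i j → cong bit (xor-same (i <ᶠ j)))))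

-- `ρ` exchanges 1 and `suc a` and is its own inverse, so the right side is a conjugate of the
-- transposition of 0 and 1, whose sign is computed directly.
transpose-conjugate : (a : Fin (suc m)) → let ρ = lift₀ (transpose 0F a) in
                      transpose 0F (suc a) Perm.≈ (ρ ∘ₚ (swap Perm.id ∘ₚ ρ))
transpose-conjugate a       0F       = refl
transpose-conjugate 0F      (suc 0F) = refl
transpose-conjugate (suc b) (suc 0F) rewrite dec-true (b ≟ b) refl = refl
transpose-conjugate 0F      (suc (suc k)) = refl
transpose-conjugate (suc b) (suc (suc k)) with k ≟ b
... | yes refl = refl
... | no  k≢b rewrite dec-false (k ≟ b) k≢b = refl

sgn-transpose : (a : Fin m) → sgn (transpose 0F (suc a)) ≡ 1ℙ
sgn-transpose {suc m} a = begin
  sgn (transpose 0F (suc a))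
    ≡⟨ sgn-cong (transpose 0F (suc a)) (ρ ∘ₚ (swap Perm.id ∘ₚ ρ)) (transpose-conjugate a) ⟩
  sgn (ρ ∘ₚ (swap Perm.id ∘ₚ ρ))
    ≡⟨ sgn-∘ ρ (swap Perm.id ∘ₚ ρ) ⟩
  sgn ρ ℙ.+ sgn (swap Perm.id ∘ₚ ρ)
    ≡⟨ cong (sgn ρ ℙ.+_) (sgn-∘ (swap Perm.id) ρ) ⟩
  sgn ρ ℙ.+ (sgn (swap (Perm.id {m})) ℙ.+ sgn ρ)
    ≡⟨ cong (λ p → sgn ρ ℙ.+ (p ℙ.+ sgn ρ)) (sgn-swap-id {m}) ⟩
  sgn ρ ℙ.+ (sgn ρ) ℙ.⁻¹
    ≡⟨ ℙ.p+p⁻¹≡1ℙ (sgn ρ) ⟩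
  1ℙ ∎
  where
  open ≡-Reasoning
  ρ : Permutation′ (2 + m)
  ρ = lift₀ (transpose 0F a)

-- Orbits and signs

infix 4 _↝[_]_
_↝[_]_ : A → (A → A) → A → Set
x ↝[ f ] y = Star (λ u v → f u ≡ v) x y

∈⇒↭ : ∀ {x : A} {xs} → x ∈ xs → ∃[ ys ] xs ↭ x ∷ ys
∈⇒↭ {x = x} x∈xs with ys , zs , refl ← ∈-∃++ x∈xs = ys ++ zs , shift x ys zs

module _ (σ : Permutation′ (suc m)) where

  -- The transposition returns the image of 0 to 0 and redirects the predecessor of 0, if it is not
  -- 0 itself, to `σ ⟨$⟩ʳ 0F`.
  fixing0 : Permutation′ (suc m)
  fixing0 = σ ∘ₚ transpose 0F (σ ⟨$⟩ʳ 0F)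

  fixing0-0 : fixing0 ⟨$⟩ʳ 0F ≡ 0F
  fixing0-0 with σ ⟨$⟩ʳ 0F
  ... | 0F = refl
  ... | suc b rewrite dec-true (b ≟ b) refl = refl

  -- σ with 0 cut out of its cycle.
  skip0 : Permutation′ m
  skip0 = remove 0F fixing0

  suc-skip0 : ∀ i → suc (skip0 ⟨$⟩ʳ i) ≡ fixing0 ⟨$⟩ʳ suc i
  suc-skip0 i = Perm.lift₀-remove fixing0 fixing0-0 (suc i)

  skip0-direct : ∀ {i j} → σ ⟨$⟩ʳ suc i ≡ suc j → skip0 ⟨$⟩ʳ i ≡ j
  skip0-direct {i} {j} σi≡j = suc-injective (trans (suc-skip0 i) lemma)
    where
    lemma : fixing0 ⟨$⟩ʳ suc i ≡ suc j
    lemma rewrite σi≡j | dec-false (suc j ≟ (σ ⟨$⟩ʳ 0F))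
      (λ eq → contradiction (permutation-injective σ (trans σi≡j eq)) λ ()) = refl

  skip0-via-0 : ∀ {i j} → σ ⟨$⟩ʳ suc i ≡ 0F → σ ⟨$⟩ʳ 0F ≡ suc j → skip0 ⟨$⟩ʳ i ≡ j
  skip0-via-0 {i} {j} σi≡0 σ0≡j = suc-injective (trans (suc-skip0 i) lemma)
    where
    lemma : fixing0 ⟨$⟩ʳ suc i ≡ suc j
    lemma rewrite σi≡0 = σ0≡j

  suc-0-distinct : ∀ {i} {B : Set} → σ ⟨$⟩ʳ suc i ≡ 0F → σ ⟨$⟩ʳ 0F ≡ 0F → B
  suc-0-distinct σi≡0 σ0≡0 =
    contradiction (permutation-injective σ (trans σi≡0 (sym σ0≡0))) λ ()

  -- A visit to 0 is absorbed into one step of `skip0`. Two zeros in a row cannot occur, because 0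
  -- would then have two preimages.
  ↝-skip0 : ∀ {i j} → suc i ↝[ σ ⟨$⟩ʳ_ ] suc j → i ↝[ skip0 ⟨$⟩ʳ_ ] j
  ↝-skip0 ε = ε
  ↝-skip0 (_◅_ {j = suc k} e p) = skip0-direct e ◅ ↝-skip0 p
  ↝-skip0 (_◅_ {j = 0F} e (_◅_ {j = 0F} e′ p)) = suc-0-distinct e e′
  ↝-skip0 (_◅_ {j = 0F} e (_◅_ {j = suc k} e′ p)) = skip0-via-0 e e′ ◅ ↝-skip0 p

  skip0-label : (ℓ : Fin (suc m) → A) → (∀ i → ℓ (σ ⟨$⟩ʳ i) ≡ ℓ i) →
                ∀ i → ℓ (suc (skip0 ⟨$⟩ʳ i)) ≡ ℓ (suc i)
  skip0-label ℓ invariant i = cases _ _ refl refl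
    where
    cases : ∀ u v → σ ⟨$⟩ʳ suc i ≡ u → σ ⟨$⟩ʳ 0F ≡ v → ℓ (suc (skip0 ⟨$⟩ʳ i)) ≡ ℓ (suc i)
    cases (suc j) _       σi σ0 =
      trans (cong (ℓ ∘ suc) (skip0-direct σi)) (trans (cong ℓ (sym σi)) (invariant (suc i)))
    cases 0F      0F      σi σ0 = suc-0-distinct σi σ0
    cases 0F      (suc j) σi σ0 =
      trans (cong (ℓ ∘ suc) (skip0-via-0 σi σ0))
      (trans (cong ℓ (sym σ0)) (trans (invariant 0F) (trans (cong ℓ (sym σi)) (invariant (suc i)))))

  -- `σ` followed by `τ` is `lift₀ skip0`; adding `sgn τ` a second time isolates `sgn σ`.
  sgn-skip0 : sgn σ ≡ sgn (transpose 0F (σ ⟨$⟩ʳ 0F)) ℙ.+ sgn skip0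
  sgn-skip0 = begin
    sgn σ                      ≡⟨ ℙ.+-identityʳ (sgn σ) ⟨
    sgn σ ℙ.+ 0ℙ               ≡⟨ cong (sgn σ ℙ.+_) (ℙ.p+p≡0ℙ (sgn τ)) ⟨
    sgn σ ℙ.+ (sgn τ ℙ.+ sgn τ) ≡⟨ ℙ.+-assoc (sgn σ) (sgn τ) (sgn τ) ⟨
    (sgn σ ℙ.+ sgn τ) ℙ.+ sgn τ ≡⟨ cong (ℙ._+ sgn τ) (sgn-∘ σ τ) ⟨
    sgn fixing0 ℙ.+ sgn τ      ≡⟨ ℙ.+-comm (sgn fixing0) (sgn τ) ⟩
    sgn τ ℙ.+ sgn fixing0
      ≡⟨ cong (sgn τ ℙ.+_) (sgn-cong (lift₀ skip0) fixing0 (Perm.lift₀-remove fixing0 fixing0-0)) ⟨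
    sgn τ ℙ.+ sgn (lift₀ skip0) ≡⟨ cong (sgn τ ℙ.+_) (sgn-lift₀ skip0) ⟩
    sgn τ ℙ.+ sgn skip0 ∎
    where
    open ≡-Reasoning
    τ : Permutation′ (suc m)
    τ = transpose 0F (σ ⟨$⟩ʳ 0F)

  ↝-fixed : σ ⟨$⟩ʳ 0F ≡ 0F → ∀ {j} → 0F ↝[ σ ⟨$⟩ʳ_ ] j → 0F ≡ j
  ↝-fixed σ0≡0 ε       = refl
  ↝-fixed σ0≡0 (e ◅ p) with refl ← trans (sym σ0≡0) e = ↝-fixed σ0≡0 p

sgn-transpose-00 : sgn (transpose {suc m} 0F 0F) ≡ 0ℙ
sgn-transpose-00 {m} = trans (sgn-cong (transpose {suc m} 0F 0F) Perm.id λ { 0F → refl ; (suc _) → refl }) (sgn-id {suc m})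

-- The fibres of `ℓ` are the orbits, so `length xs` is their number; modulo 2 adding it to `m` is
-- the same as subtracting it. The induction cuts 0 out of its cycle.
sgn-orbits : (σ : Permutation′ m) (ℓ : Fin m → A) (xs : List A) →
             (∀ i → ℓ (σ ⟨$⟩ʳ i) ≡ ℓ i) →
             (∀ i j → ℓ i ≡ ℓ j → i ↝[ σ ⟨$⟩ʳ_ ] j) →
             Unique xs → (∀ i → ℓ i ∈ xs) → (∀ {x} → x ∈ xs → ∃[ i ] ℓ i ≡ x) →
             sgn σ ≡ parity (m + length xs)
sgn-orbits {zero} σ ℓ []       invariant transitive uniq ∈xs onto = refl
sgn-orbits {zero} σ ℓ (x ∷ xs) invariant transitive uniq ∈xs onto with () ← proj₁ (onto (here refl))
sgn-orbits {suc m} σ ℓ xs invariant transitive uniq ∈xs onto = by-image _ refl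
  where
  open ≡-Reasoning
  transitive′ : ∀ i j → ℓ (suc i) ≡ ℓ (suc j) → i ↝[ skip0 σ ⟨$⟩ʳ_ ] j
  transitive′ i j eq = ↝-skip0 σ (transitive (suc i) (suc j) eq)

  by-image : ∀ v → σ ⟨$⟩ʳ 0F ≡ v → sgn σ ≡ parity (suc m + length xs)
  -- The orbit of 0 is a singleton: size and number of orbits both drop by one, and the sign is
  -- unchanged.
  by-image 0F σ0 with xs′ , xs↭ ← ∈⇒↭ (∈xs 0F) = begin
    sgn σ                                  ≡⟨ sgn-skip0 σ ⟩
    sgn (transpose 0F (σ ⟨$⟩ʳ 0F)) ℙ.+ sgn (skip0 σ)
      ≡⟨ cong₂ (λ b p → sgn (transpose 0F b) ℙ.+ p) σ0
           (sgn-orbits (skip0 σ) (ℓ ∘ suc) xs′ (skip0-label σ ℓ invariant) transitive′ uniq′ ∈xs′ onto′) ⟩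
    sgn (transpose {suc m} 0F 0F) ℙ.+ parity (m + length xs′)
      ≡⟨ cong (ℙ._+ parity (m + length xs′)) (sgn-transpose-00 {m}) ⟩
    parity (suc (suc (m + length xs′)))    ≡⟨ cong (λ k → parity (suc k)) (+-suc m _) ⟨
    parity (suc (m + suc (length xs′)))    ≡⟨ cong (λ k → parity (suc (m + k))) (↭-length xs↭) ⟨
    parity (suc (m + length xs))           ∎
    where
    uniq∷ : Unique (ℓ 0F ∷ xs′)
    uniq∷ = ↭ₛ.Unique-resp-↭ (setoid _) (↭⇒↭ₛ xs↭) uniq
    uniq′ : Unique xs′
    uniq′ with _ ∷ u ← uniq∷ = u
    ∈xs′ : ∀ i → ℓ (suc i) ∈ xs′
    ∈xs′ i with ∈-resp-↭ xs↭ (∈xs (suc i))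
    ... | there p = p
    -- An index with the label of 0 would lie in the orbit of 0, which contains only 0.
    ... | here eq = contradiction (↝-fixed σ σ0 (transitive 0F (suc i) (sym eq))) λ ()
    onto′ : ∀ {x} → x ∈ xs′ → ∃[ i ] ℓ (suc i) ≡ x
    onto′ x∈ with onto (∈-resp-↭ (↭-sym xs↭) (there x∈))
    ... | suc i , eq   = i , eq
    ... | 0F    , refl = contradiction x∈ (Unique.Unique[x∷xs]⇒x∉xs uniq∷)
  -- The number of orbits stays the same while the size drops by one, which the odd transposition
  -- makes up for.
  by-image (suc b) σ0 = begin
    sgn σ                                  ≡⟨ sgn-skip0 σ ⟩
    sgn (transpose 0F (σ ⟨$⟩ʳ 0F)) ℙ.+ sgn (skip0 σ)
      ≡⟨ cong₂ (λ b p → sgn (transpose 0F b) ℙ.+ p) σ0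
           (sgn-orbits (skip0 σ) (ℓ ∘ suc) xs (skip0-label σ ℓ invariant) transitive′ uniq (∈xs ∘ suc) onto′) ⟩
    sgn (transpose 0F (suc b)) ℙ.+ parity (m + length xs)
      ≡⟨ cong (ℙ._+ parity (m + length xs)) (sgn-transpose b) ⟩
    1ℙ ℙ.+ parity (m + length xs)          ≡⟨ ℙ.+-homo-+ 1 (m + length xs) ⟨
    parity (suc (m + length xs))           ∎
    where
    onto′ : ∀ {x} → x ∈ xs → ∃[ i ] ℓ (suc i) ≡ x
    onto′ x∈ with onto x∈
    ... | suc i , eq   = i , eq
    -- The label of 0 survives, since `suc b`, the image of 0, carries it too.
    ... | 0F    , refl = b , trans (cong ℓ (sym σ0)) (invariant 0F)

-- Bracket codes

closings : List Bracket → ℕ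
closings []             = 0
closings (opening ∷ bs) = closings bs
closings (closing ∷ bs) = 1 + closings bs

openings-++ : ∀ xs ys → openings (xs ++ ys) ≡ openings xs + openings ys
openings-++ []             ys = refl
openings-++ (opening ∷ xs) ys = cong suc (openings-++ xs ys)
openings-++ (closing ∷ xs) ys = openings-++ xs ys

closings-++ : ∀ xs ys → closings (xs ++ ys) ≡ closings xs + closings ys
closings-++ []             ys = refl
closings-++ (opening ∷ xs) ys = closings-++ xs ys
closings-++ (closing ∷ xs) ys = cong suc (closings-++ xs ys)

-- The product counts the mixed inversions: each closing bracket of `xs` precedes each opening one
-- of `ys`.
inversions-++ : ∀ xs ys → inversions (xs ++ ys) ≡ inversions xs + inversions ys + closings xs * openings ys
inversions-++ []             ys = sym (+-identityʳ _)
inversions-++ (opening ∷ xs) ys = inversions-++ xs ys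
inversions-++ (closing ∷ xs) ys rewrite openings-++ xs ys | inversions-++ xs ys =
  regroup (openings xs) (openings ys) (inversions xs) (inversions ys) (closings xs)
  where
  regroup : ∀ ox oy ix iy cx → ox + oy + (ix + iy + cx * oy) ≡ ox + ix + iy + (oy + cx * oy)
  regroup = solve-∀

-- The numbers of vertices at even and at odd depth, the root being at depth 0; passing to the
-- subtrees exchanges the two.
evens  : PRTree → ℕ
odds   : PRTree → ℕ
evensF : List PRTree → ℕ
oddsF  : List PRTree → ℕ

evens (node ts) = suc (oddsF ts)
odds  (node ts) = evensF ts

evensF []       = 0
evensF (t ∷ ts) = evens t + evensF ts

oddsF []       = 0
oddsF (t ∷ ts) = odds t + oddsF ts

-- The sum of ⌊ depth / 2 ⌋ over all vertices.
halfDepths  : PRTree → ℕ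
halfDepthsF : List PRTree → ℕ

halfDepths (node ts) = oddsF ts + halfDepthsF ts

halfDepthsF []       = 0
halfDepthsF (t ∷ ts) = halfDepths t + halfDepthsF ts

openings-code  : ∀ t → openings (code t) ≡ evens t + odds t
openings-codes : ∀ ts → openings (codes ts) ≡ evensF ts + oddsF ts

openings-code (node ts) rewrite openings-++ (codes ts) (closing ∷ []) | openings-codes ts =
  regroup (evensF ts) (oddsF ts)
  where
  regroup : ∀ e o → 1 + (e + o + 0) ≡ 1 + (o + e)
  regroup = solve-∀

openings-codes []       = refl
openings-codes (t ∷ ts) rewrite openings-++ (code t) (codes ts) | openings-code t | openings-codes ts =
  regroup (evens t) (odds t) (evensF ts) (oddsF ts)
  where
  regroup : ∀ e o e′ o′ → e + o + (e′ + o′) ≡ e + e′ + (o + o′)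
  regroup = solve-∀

closings-code  : ∀ t → closings (code t) ≡ openings (code t)
closings-codes : ∀ ts → closings (codes ts) ≡ openings (codes ts)

closings-code (node ts)
  rewrite closings-++ (codes ts) (closing ∷ []) | openings-++ (codes ts) (closing ∷ []) | closings-codes ts =
  +-suc (openings (codes ts)) 0

closings-codes []       = refl
closings-codes (t ∷ ts)
  rewrite closings-++ (code t) (codes ts) | openings-++ (code t) (codes ts) =
  cong₂ _+_ (closings-code t) (closings-codes ts)

-- The number n (n - 1) / 2 of pairs among n objects, which is also the sum of the indices 0 to n -
-- 1.
tri : ℕ → ℕ
tri zero    = 0
tri (suc n) = n + tri n

-- A pair lies within the first `a` objects, within the last `b`, or across.
tri-+ : ∀ a b → tri (a + b) ≡ tri a + tri b + a * b
tri-+ zero    b = sym (+-identityʳ (tri b))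
tri-+ (suc a) b rewrite tri-+ a b = regroup a b (tri a) (tri b)
  where
  regroup : ∀ a b ta tb → a + b + (ta + tb + a * b) ≡ a + ta + tb + (b + a * b)
  regroup = solve-∀

-- The closings before the i-th opening, counted from 0, number i minus the
-- depth of the vertex that it opens.
inversions-code  : ∀ t → inversions (code t) + odds t + 2 * halfDepths t ≡ tri (openings (code t))
inversions-codes : ∀ ts → inversions (codes ts) + oddsF ts + 2 * halfDepthsF ts ≡ tri (openings (codes ts))

inversions-code (node ts) = begin
  inversions (codes ts ++ closing ∷ []) + e + 2 * (o + h)
    ≡⟨ cong (λ i → i + e + 2 * (o + h)) (inversions-++ (codes ts) (closing ∷ [])) ⟩
  inversions (codes ts) + 0 + closings (codes ts) * 0 + e + 2 * (o + h)
    ≡⟨ regroup (inversions (codes ts)) (closings (codes ts)) e o h ⟩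
  (e + o) + (inversions (codes ts) + o + 2 * h)
    ≡⟨ cong₂ _+_ (sym (openings-codes ts)) (inversions-codes ts) ⟩
  tri (suc (openings (codes ts)))
    ≡⟨ cong (λ k → tri (suc k)) (trans (openings-++ (codes ts) (closing ∷ [])) (+-identityʳ _)) ⟨
  tri (suc (openings (codes ts ++ closing ∷ []))) ∎
  where
  open ≡-Reasoning
  e o h : ℕ
  e = evensF ts
  o = oddsF ts
  h = halfDepthsF ts
  regroup : ∀ i c e o h → i + 0 + c * 0 + e + 2 * (o + h) ≡ (e + o) + (i + o + 2 * h)
  regroup = solve-∀

inversions-codes []       = refl
inversions-codes (t ∷ ts)
  rewrite inversions-++ (code t) (codes ts) | openings-++ (code t) (codes ts)
        | tri-+ (openings (code t)) (openings (codes ts)) | closings-code t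
        | sym (inversions-code t) | sym (inversions-codes ts) =
  regroup (inversions (code t)) (inversions (codes ts)) (openings (code t) * openings (codes ts))
          (odds t) (oddsF ts) (halfDepths t) (halfDepthsF ts)
  where
  regroup : ∀ i i′ p o o′ h h′ →
            i + i′ + p + (o + o′) + 2 * (h + h′) ≡ i + o + 2 * h + (i′ + o′ + 2 * h′) + p
  regroup = solve-∀

-- The depths enter `inversions-code` as odd depths plus twice `halfDepths`, and the doubled term
-- vanishes modulo 2.
parity-inversions : ∀ t → parity (inversions (code t)) ℙ.+ parity (odds t) ≡ parity (tri (openings (code t)))
parity-inversions t = begin
  parity i ℙ.+ parity o              ≡⟨ ℙ.+-homo-+ i o ⟨
  parity (i + o)                     ≡⟨ ℙ.+-identityʳ _ ⟨
  parity (i + o) ℙ.+ 0ℙ              ≡⟨ cong (parity (i + o) ℙ.+_) (ℙ.*-homo-* 2 h) ⟨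
  parity (i + o) ℙ.+ parity (2 * h)  ≡⟨ ℙ.+-homo-+ (i + o) (2 * h) ⟨
  parity (i + o + 2 * h)             ≡⟨ cong parity (inversions-code t) ⟩
  parity (tri (openings (code t)))   ∎
  where
  open ≡-Reasoning
  i o h : ℕ
  i = inversions (code t)
  o = odds t
  h = halfDepths t

-- Cyclic orders and lists without repetition

-- The pigeonhole principle: the head of `xs` is removed from `ys`, and the rest of `xs` remains
-- included because the head does not recur.
unique-⊆-length : {A : Set} {xs ys : List A} → Unique xs → xs ⊆ ys → length xs ≤ length ys
unique-⊆-length {xs = []}     uniq       sub = z≤n
unique-⊆-length {xs = x ∷ xs} uniq∷@(_ ∷ uniq) sub with ys′ , ys↭ ← ∈⇒↭ (sub (here refl)) =
  ≤-trans (s≤s (unique-⊆-length uniq sub′)) (≤-reflexive (sym (↭-length ys↭)))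
  where
  sub′ : xs ⊆ ys′
  sub′ y∈xs with ∈-resp-↭ ys↭ (sub (there y∈xs))
  ... | here refl = contradiction y∈xs (Unique.Unique[x∷xs]⇒x∉xs uniq∷)
  ... | there y∈ys′ = y∈ys′

module _ {A : Set} (f : A → A) where

  fold-shift : ∀ k a → fold (f a) f k ≡ f (fold a f k)
  fold-shift zero    a = refl
  fold-shift (suc k) a = cong f (fold-shift k a)

  iterate-step : ∀ p a {x} → x ∈ iterate f a p → f x ∈ iterate f a p ⊎ f x ≡ fold a f p
  iterate-step (suc zero)    a (here refl) = inj₂ refl
  iterate-step (suc (suc p)) a (here refl) = inj₁ (there (here refl))
  iterate-step (suc p)       a (there x∈) with iterate-step p (f a) x∈
  ... | inj₁ fx∈ = inj₁ (there fx∈)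
  ... | inj₂ eq  = inj₂ (trans eq (fold-shift p a))

  ∈-iterate⇒fold : ∀ p a {x} → x ∈ iterate f a p → ∃[ k ] k < p × fold a f k ≡ x
  ∈-iterate⇒fold (suc p) a (here refl) = 0 , s≤s z≤n , refl
  ∈-iterate⇒fold (suc p) a (there x∈) with k , k<p , eq ← ∈-iterate⇒fold p (f a) x∈ =
    suc k , s≤s k<p , trans (sym (fold-shift k a)) eq

  iterate-mono : ∀ {p q} → p ≤ q → ∀ a → iterate f a p ⊆ iterate f a q
  iterate-mono (s≤s p≤q) a (here eq)  = here eq
  iterate-mono (s≤s p≤q) a (there x∈) = there (iterate-mono p≤q (f a) x∈)

  iterate-periodic : ∀ p a → fold a f (suc p) ≡ a → ∀ k → fold a f k ∈ iterate f a (suc p)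
  iterate-periodic p a eq zero    = here refl
  iterate-periodic p a eq (suc k) with iterate-step (suc p) a (iterate-periodic p a eq k)
  ... | inj₁ fx∈ = fx∈
  ... | inj₂ eq′ = here (trans eq′ eq)

  module _ (_≟_ : DecidableEquality A) (f-injective : ∀ {x y} → f x ≡ f y → x ≡ y) where
    open DecMembership _≟_ using (_∈?_)
    open DecUnique _≟_ using (unique?)

    -- Either `a` itself recurs, or the repetition lies in the list starting at `f a`; in the second
    -- case injectivity carries the return of `f a` back to `a`.
    iterate-repeat : ∀ q a → ¬ Unique (iterate f a q) → ∃[ p ] suc p < q × fold a f (suc p) ≡ a
    iterate-repeat zero    a ¬uniq = contradiction [] ¬uniq
    iterate-repeat (suc q) a ¬uniq with a ∈? iterate f (f a) q
    ... | yes a∈ with k , k<q , eq ← ∈-iterate⇒fold q (f a) a∈ =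
      k , s≤s k<q , trans (sym (fold-shift k a)) eq
    ... | no  a∉ with p , p<q , eq ← iterate-repeat q (f a) (λ uniq → ¬uniq (¬Any⇒All¬ _ a∉ ∷ uniq)) =
      p , m≤n⇒m≤1+n p<q , f-injective (trans (sym (fold-shift (suc p) a)) eq)

    module _ {a : A} (transitive : (b : A) → ∃[ k ] fold a f k ≡ b) {d : ℕ}
             (unique-≤ : (xs : List A) → Unique xs → length xs ≤ d)
             (complete-≥ : (xs : List A) → (∀ b → b ∈ xs) → d ≤ length xs) where

      periodic-complete : ∀ p → fold a f (suc p) ≡ a → ∀ b → b ∈ iterate f a (suc p)
      periodic-complete p eq b with k , refl ← transitive b = iterate-periodic p a eq k

      -- The two bounds on list lengths say that `A` has `d` elements. Hence `suc d` iterates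
      -- contain a repetition, so `a` returns after at most `d` steps, and one full period meets
      -- everything.
      iterate-complete : ∀ b → b ∈ iterate f a d
      iterate-complete b
        with p , s≤s p<d , eq ← iterate-repeat (suc d) a (λ uniq → n≮n d (subst (_≤ d)
          (length-iterate f a (suc d)) (unique-≤ _ uniq))) =
        iterate-mono p<d a (periodic-complete p eq b)

      -- A repetition would give a period shorter than `d`, hence a complete list with fewer than
      -- `d` entries.
      iterate-unique : Unique (iterate f a d)
      iterate-unique = decidable-stable (unique? (iterate f a d)) λ ¬uniq →
        let p , p<d , eq = iterate-repeat d a ¬uniq in
        <⇒≱ p<d (subst (d ≤_) (length-iterate f a (suc p)) (complete-≥ _ (periodic-complete p eq)))

-- The vertices of a rooted plane tree

module _ {n : ℕ} (T : Tree n) where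
  open Tree T

  -- Walks with at least one edge and no backtracking; the condition `x ≢ z` forbids going straight
  -- back along the last edge.
  data Reduced : List (Fin n) → Set where
    edge : ∀ {x y} → Adj x y → Reduced (x ∷ y ∷ [])
    step : ∀ {x y z ws} → Adj x y → x ≢ z → Reduced (y ∷ z ∷ ws) → Reduced (x ∷ y ∷ z ∷ ws)

  reduced⇒linked : ∀ {ws} → Reduced ws → Linked Adj ws
  reduced⇒linked (edge a)     = a ∷ [-]
  reduced⇒linked (step a _ r) = a ∷ reduced⇒linked r

  linked-prefix : ∀ xs {z ws} → Linked Adj (xs ++ z ∷ ws) → Linked Adj (xs ∷ʳ z)
  linked-prefix []           _       = [-]
  linked-prefix (x ∷ [])     (a ∷ _) = a ∷ [-]
  linked-prefix (x ∷ y ∷ xs) (a ∷ l) = a ∷ linked-prefix (y ∷ xs) l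

  -- Moves `z`, the start of the cycle to be closed, to the front, as `acyclic` demands.
  unique-prefix : ∀ {A : Set} (xs : List A) {z ws} → Unique (xs ++ z ∷ ws) → Unique (z ∷ xs)
  unique-prefix []       _          = [] ∷ []
  unique-prefix (x ∷ xs) (x∉ ∷ u) with z∉xs ∷ uxs ← unique-prefix xs u =
    (≢-sym (All.head (++⁻ʳ xs x∉)) ∷ z∉xs) ∷ ++⁻ˡ xs x∉ ∷ uxs

  -- The first return of a reduced walk to its starting point would be a cycle.
  reduced⇒unique : ∀ {ws} → Reduced ws → Unique ws
  reduced-head : ∀ {x ws} → Reduced (x ∷ ws) → Unique ws → x ∉ ws

  reduced⇒unique r@(edge _)      = ¬Any⇒All¬ _ (reduced-head r ([] ∷ [])) ∷ [] ∷ []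
  reduced⇒unique r@(step _ _ r′) = ¬Any⇒All¬ _ (reduced-head r (reduced⇒unique r′)) ∷ reduced⇒unique r′

  reduced-head {x} r u x∈ws with ∈-∃++ x∈ws
  -- A return after one edge is a loop and after two edges a backtrack; from three edges on it is a
  -- cycle.
  reduced-head (edge a)     u _ | []          , _ , refl = irrefl refl a
  reduced-head (step a _ _) u _ | []          , _ , refl = irrefl refl a
  reduced-head (edge a)     u _ | _ ∷ []      , _ , ()
  reduced-head (step _ p _) u _ | _ ∷ []      , _ , refl = p refl
  reduced-head {x} r u _ | y ∷ z ∷ ys , _ , refl =
    acyclic x (y ∷ z ∷ ys) (s≤s (s≤s z≤n)) (unique-prefix (y ∷ z ∷ ys) u)
      (linked-prefix (x ∷ y ∷ z ∷ ys) (reduced⇒linked r))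

module _ {n : ℕ} (T : PlaneTree n) where
  open PlaneTree T

  neighbours : Fin n → List (Fin n)
  neighbours v = filter (Adj? v) (allFin n)

  module _ {v : Fin n} where
    infix 4 _≟ₙ_
    _≟ₙ_ : DecidableEquality (Neighbour v)
    _≟ₙ_ = Refinement._≟_ _≟_

    adjacent : (a : Neighbour v) → Adj v (value a)
    adjacent (u , [ v~u ]) = recompute (Adj? v u) v~u

    unique-neighbours : (xs : List (Neighbour v)) → Unique xs → length xs ≤ degree v
    unique-neighbours xs uniq = subst (_≤ degree v) (length-map value xs)
      (unique-⊆-length (Unique.map⁺ value-injective uniq) sub)
      where
      sub : map value xs ⊆ neighbours v
      sub u∈ with a , _ , refl ← ∈-map⁻ value u∈ = ∈-filter⁺ (Adj? v) (∈-allFin _) (adjacent a)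

    complete-neighbours : (xs : List (Neighbour v)) → (∀ b → b ∈ xs) → degree v ≤ length xs
    complete-neighbours xs all∈ = subst (degree v ≤_) (length-map value xs)
      (unique-⊆-length (Unique.filter⁺ (Adj? v) (Unique.allFin⁺ n)) sub)
      where
      sub : neighbours v ⊆ map value xs
      sub u∈ with _ , v~u ← ∈-filter⁻ (Adj? v) {xs = allFin n} u∈ = ∈-map⁺ value (all∈ (_ , [ v~u ]))

    next-injective : {a b : Neighbour v} → next v a ≡ next v b → a ≡ b
    next-injective = Injection.injective (↔⇒↣ (rotation v))

    edges-complete : (a b : Neighbour v) → b ∈ edgesFrom a
    edges-complete a = iterate-complete (next v) _≟ₙ_ next-injective (cyclic v a) unique-neighbours complete-neighbours

    edges-unique : (a : Neighbour v) → Unique (edgesFrom a)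
    edges-unique a = iterate-unique (next v) _≟ₙ_ next-injective (cyclic v a) unique-neighbours complete-neighbours

    edges-∷ : (a : Neighbour v) → edgesFrom a ≡ a ∷ drop 1 (edgesFrom a)
    -- The edge `a` occurs in the list, so the degree is not 0.
    edges-∷ a with degree v | edges-complete a a
    ... | suc _ | _ = refl

  module _ {v : Fin n} (c : Neighbour v) where

    children : List (Neighbour (value c))
    children = drop 1 (edgesFrom (back c))

    edges-back : edgesFrom (back c) ≡ back c ∷ children
    edges-back = edges-∷ (back c)

    unique-back : Unique (back c ∷ children)
    unique-back = subst Unique edges-back (edges-unique (back c))

    children-complete : ∀ b → value b ≡ v ⊎ b ∈ children
    children-complete b with subst (b ∈_) edges-back (edges-complete (back c) b)
    ... | here refl = inj₁ refl
    ... | there b∈  = inj₂ b∈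

    children-unique : Unique children
    children-unique with _ ∷ uniq ← unique-back = uniq

    child≢parent : ∀ {a} → a ∈ children → value a ≢ v
    child≢parent a∈ refl = Unique.Unique[x∷xs]⇒x∉xs unique-back a∈

    -- Walks run from a vertex up through its parent; a child is put in front, and `child≢parent`
    -- excludes backtracking.
    children-reduced : ∀ {ws} → Reduced tree (value c ∷ v ∷ ws) →
                       All (λ a → Reduced tree (value a ∷ value c ∷ v ∷ ws)) children
    children-reduced r = All.tabulate λ {a} a∈ → step (symmetric (adjacent a)) (child≢parent a∈) r

  -- Read off the derivation, since a `PRTree` does not name its vertices.
  vertices  : ∀ {v} {c : Neighbour v} {t} → SubtreeAt T c t → List (Fin n)
  verticesF : ∀ {v} {as : List (Neighbour v)} {ts} → Pointwise (SubtreeAt T) as ts → List (Fin n)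

  vertices {c = c} (node p) = value c ∷ verticesF p

  verticesF []      = []
  verticesF (s ∷ p) = vertices s ++ verticesF p

  top∈vertices : ∀ {v} {c : Neighbour v} {t} (s : SubtreeAt T c t) → value c ∈ vertices s
  top∈vertices (node p) = here refl

  tops∈verticesF : ∀ {v} {as : List (Neighbour v)} {ts} (p : Pointwise (SubtreeAt T) as ts) →
                   ∀ {a} → a ∈ as → value a ∈ verticesF p
  tops∈verticesF (s ∷ p) (here refl) = ∈-++⁺ˡ (top∈vertices s)
  tops∈verticesF (s ∷ p) (there a∈)  = ∈-++⁺ʳ (vertices s) (tops∈verticesF p a∈)

  -- At the top vertex every edge other than the one to `v` leads to a child, and a subtree further
  -- down can only be left towards its own parent.
  vertices-closed : ∀ {v} {c : Neighbour v} {t} (s : SubtreeAt T c t) →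
                    ∀ {u w} → u ∈ vertices s → Adj u w → w ≡ v ⊎ w ∈ vertices s
  verticesF-closed : ∀ {v} {as : List (Neighbour v)} {ts} (p : Pointwise (SubtreeAt T) as ts) →
                     ∀ {u w} → u ∈ verticesF p → Adj u w → w ≡ v ⊎ w ∈ verticesF p

  vertices-closed {c = c} (node p) (here refl) u~w with children-complete c (_ , [ u~w ])
  ... | inj₁ w≡v = inj₁ w≡v
  ... | inj₂ w∈  = inj₂ (there (tops∈verticesF p w∈))
  vertices-closed (node p) (there u∈) u~w with verticesF-closed p u∈ u~w
  ... | inj₁ w≡c = inj₂ (here w≡c)
  ... | inj₂ w∈  = inj₂ (there w∈)

  verticesF-closed (s ∷ p) u∈ u~w with ∈-++⁻ (vertices s) u∈
  ... | inj₁ u∈s with vertices-closed s u∈s u~w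
  ...   | inj₁ w≡v = inj₁ w≡v
  ...   | inj₂ w∈s = inj₂ (∈-++⁺ˡ w∈s)
  verticesF-closed (s ∷ p) u∈ u~w | inj₂ u∈p with verticesF-closed p u∈p u~w
  ...   | inj₁ w≡v = inj₁ w≡v
  ...   | inj₂ w∈p = inj₂ (∈-++⁺ʳ (vertices s) w∈p)

  -- The given walk is extended downwards to `u`; it stays reduced, so `u` cannot recur further
  -- along it.
  vertices-avoid : ∀ {v} {c : Neighbour v} {t} (s : SubtreeAt T c t) {ws} →
                   Reduced tree (value c ∷ v ∷ ws) → ∀ {u} → u ∈ vertices s → u ∉ v ∷ ws
  verticesF-avoid : ∀ {v} {as : List (Neighbour v)} {ts} (p : Pointwise (SubtreeAt T) as ts) {ws} →
                    All (λ a → Reduced tree (value a ∷ v ∷ ws)) as → ∀ {u} → u ∈ verticesF p → u ∉ v ∷ ws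

  vertices-avoid (node p) r (here refl) = Unique.Unique[x∷xs]⇒x∉xs (reduced⇒unique tree r)
  vertices-avoid {c = c} (node p) r (there u∈) = verticesF-avoid p (children-reduced c r) u∈ ∘ there

  verticesF-avoid (s ∷ p) (r ∷ rs) u∈ with ∈-++⁻ (vertices s) u∈
  ... | inj₁ u∈s = vertices-avoid s r u∈s
  ... | inj₂ u∈p = verticesF-avoid p rs u∈p

  -- The descent from `v` to `u` never turns back, by `child≢parent`. Together with `vertices-avoid`
  -- it separates sibling subtrees.
  vertices-reach : ∀ {v} {c : Neighbour v} {t} (s : SubtreeAt T c t) → ∀ {u} → u ∈ vertices s →
                   ∃[ ws ] Reduced tree (v ∷ value c ∷ ws) × u ∈ value c ∷ ws
  verticesF-reach : ∀ {v} {as : List (Neighbour v)} {ts} (p : Pointwise (SubtreeAt T) as ts) →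
                    ∀ {u} → u ∈ verticesF p →
                    ∃[ a ] a ∈ as × ∃[ ws ] Reduced tree (v ∷ value a ∷ ws) × u ∈ value a ∷ ws

  vertices-reach {c = c} (node p) (here refl) = [] , edge (adjacent c) , here refl
  vertices-reach {c = c} (node p) (there u∈) with a , a∈ , ws , r , u∈ws ← verticesF-reach p u∈ =
    value a ∷ ws , step (adjacent c) (≢-sym (child≢parent c a∈)) r , there u∈ws

  verticesF-reach (s ∷ p) u∈ with ∈-++⁻ (vertices s) u∈
  ... | inj₁ u∈s = _ , here refl , vertices-reach s u∈s
  ... | inj₂ u∈p with a , a∈ , reach ← verticesF-reach p u∈p = a , there a∈ , reach

  toParent : ∀ {v} (a : Neighbour v) → Reduced tree (value a ∷ v ∷ [])
  toParent a = edge (symmetric (adjacent a))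

  -- The forest version includes the parent `v`, which makes the node case immediate; `v` is
  -- excluded from the forest by the one-edge walks `toParent`.
  vertices-unique : ∀ {v} {c : Neighbour v} {t} (s : SubtreeAt T c t) → Unique (vertices s)
  verticesF-unique : ∀ {v} {as : List (Neighbour v)} {ts} (p : Pointwise (SubtreeAt T) as ts) →
                     Unique as → Unique (v ∷ verticesF p)
  vertices-disjoint : ∀ {v} {a : Neighbour v} {as t ts}
                      (s : SubtreeAt T a t) (p : Pointwise (SubtreeAt T) as ts) →
                      a ∉ as → Disjoint (vertices s) (verticesF p)

  vertices-unique {c = c} (node p) = verticesF-unique p (children-unique c)

  verticesF-unique {v} p uniq =
    ¬Any⇒All¬ _ (λ v∈ → verticesF-avoid p (All.tabulate λ {a} _ → toParent a) v∈ (here refl)) ∷ tail p uniq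
    where
    tail : ∀ {as : List (Neighbour v)} {ts} (p : Pointwise (SubtreeAt T) as ts) →
           Unique as → Unique (verticesF p)
    tail []      _             = []
    tail (s ∷ p) uniq@(_ ∷ us) =
      Unique.++⁺ (vertices-unique s) (tail p us) (vertices-disjoint s p (Unique.Unique[x∷xs]⇒x∉xs uniq))

  -- A common vertex u would close up to a reduced walk from u through a, v and
  -- another neighbour b of v back to u.
  vertices-disjoint {a = a} s p a∉as (u∈s , u∈p) with b , b∈ , ws , r , u∈ws ← verticesF-reach p u∈p =
    vertices-avoid s (step (symmetric (adjacent a)) (λ a≡b → a∉as (subst (_∈ _) (sym (value-injective a≡b)) b∈)) r)
      u∈s (there u∈ws)

  module _ {root : Fin n} {marked : Neighbour root} {ts : List PRTree}
           (p : Pointwise (SubtreeAt T) (edgesFrom marked) ts) where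

    rooted-unique : Unique (root ∷ verticesF p)
    rooted-unique = verticesF-unique p (edges-unique marked)

    rooted-closed : ∀ {u w} → u ∈ root ∷ verticesF p → Adj u w → w ∈ root ∷ verticesF p
    rooted-closed (here refl) u~w = there (tops∈verticesF p (edges-complete marked (_ , [ u~w ])))
    rooted-closed (there u∈)  u~w with verticesF-closed p u∈ u~w
    ... | inj₁ refl = here refl
    ... | inj₂ w∈   = there w∈

    -- The list contains the root and is closed under adjacency, so connectedness puts every vertex
    -- in it.
    rooted-complete : ∀ u → u ∈ root ∷ verticesF p
    rooted-complete u = along (connected root u) (here refl)
      where
      along : ∀ {x y} → Star Adj x y → x ∈ root ∷ verticesF p → y ∈ root ∷ verticesF p
      along ε        x∈ = x∈
      along (a ◅ as) x∈ = along as (rooted-closed x∈ a)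

    rooted-length : length (root ∷ verticesF p) ≡ n
    rooted-length = trans
      (≤-antisym (unique-⊆-length rooted-unique λ _ → ∈-allFin _)
                 (unique-⊆-length (Unique.allFin⁺ n) λ _ → rooted-complete _))
      (length-tabulate {n = n} id)

-- Colours and rotation groups

parity-even : ∀ {k} → 2 ∣ k → parity k ≡ 0ℙ
parity-even (divides q refl) = trans (ℙ.*-homo-* q 2) (ℙ.*-zeroʳ (parity q))

even-parity : ∀ k → parity k ≡ 0ℙ → 2 ∣ k
even-parity zero          eq = divides 0 refl
even-parity (suc (suc k)) eq with divides q refl ← even-parity k eq = divides (suc q) refl

parity-odd : ∀ {k} → ¬ 2 ∣ k → parity k ≡ 1ℙ
parity-odd {k} ¬even with parity k in eq
... | 0ℙ = contradiction (even-parity k eq) ¬even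
... | 1ℙ = refl

infix 4 _≟ᶜ_
_≟ᶜ_ : DecidableEquality Colour
black ≟ᶜ black = yes refl
black ≟ᶜ white = no λ ()
white ≟ᶜ black = no λ ()
white ≟ᶜ white = yes refl

opposite : Colour → Colour
opposite black = white
opposite white = black

opposite-involutive : ∀ κ → opposite (opposite κ) ≡ κ
opposite-involutive black = refl
opposite-involutive white = refl

≢⇒opposite : ∀ {κ κ′} → κ ≢ κ′ → κ′ ≡ opposite κ
≢⇒opposite {black} {black} κ≢ = contradiction refl κ≢
≢⇒opposite {black} {white} κ≢ = refl
≢⇒opposite {white} {black} κ≢ = refl
≢⇒opposite {white} {white} κ≢ = contradiction refl κ≢

fold-↝ : {A : Set} {f : A → A} {a : A} → ∀ k → a ↝[ f ] fold a f k
fold-↝ zero    = ε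
fold-↝ (suc k) = fold-↝ k ◅◅ (refl ◅ ε)

-- The common sign of the two rotations: the last two terms give the parity of the number of
-- vertices at odd depth, which for even `n` is that of either colour class.
rotationSign : ℕ → ℕ → PRTree → Parity
rotationSign m n t = parity m ℙ.+ parity (tri n) ℙ.+ parity (inversions (code t))

module _ {n : ℕ} {T : PlaneTree n} (B : BipartiteStructure T) where
  open PlaneTree T
  open BipartiteStructure B

  ofColour : Colour → List (Fin n) → List (Fin n)
  ofColour κ = filter (λ u → colour u ≟ᶜ κ)

  count : Colour → List (Fin n) → ℕ
  count κ us = length (ofColour κ us)

  count-++ : ∀ κ us us′ → count κ (us ++ us′) ≡ count κ us + count κ us′
  count-++ κ us us′ = trans (cong length (filter-++ (λ u → colour u ≟ᶜ κ) us us′)) (length-++ (ofColour κ us))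

  count-∷-yes : ∀ {κ u} us → colour u ≡ κ → count κ (u ∷ us) ≡ suc (count κ us)
  count-∷-yes us eq = cong length (filter-accept (λ u → colour u ≟ᶜ _) eq)

  count-∷-no : ∀ {κ u} us → colour u ≢ κ → count κ (u ∷ us) ≡ count κ us
  count-∷-no us neq = cong length (filter-reject (λ u → colour u ≟ᶜ _) neq)

  neighbour-colour : ∀ {u v} → Adj u v → colour v ≡ opposite (colour u)
  neighbour-colour u~v = ≢⇒opposite (proper u~v)

  colour-≢ : ∀ {u κ} → colour u ≡ κ → colour u ≢ opposite κ
  colour-≢ {κ = black} eq eq′ with () ← trans (sym eq) eq′
  colour-≢ {κ = white} eq eq′ with () ← trans (sym eq) eq′

  -- Colours alternate along edges, so the vertices at even depth are those with the colour of the
  -- top.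
  count-vertices  : ∀ {v} {c : Neighbour v} {t} (s : SubtreeAt T c t) →
                    count (colour (value c)) (vertices T s) ≡ evens t ×
                    count (opposite (colour (value c))) (vertices T s) ≡ odds t
  count-verticesF : ∀ {v} {as : List (Neighbour v)} {ts} (p : Pointwise (SubtreeAt T) as ts) →
                    count (opposite (colour v)) (verticesF T p) ≡ evensF ts ×
                    count (colour v) (verticesF T p) ≡ oddsF ts

  count-vertices (node p) with ev , od ← count-verticesF p =
    trans (count-∷-yes (verticesF T p) refl) (cong suc od) ,
    trans (count-∷-no (verticesF T p) (colour-≢ refl)) ev

  count-verticesF []      = refl , refl
  count-verticesF {v} (_∷_ {x = a} s p)
    with ev , od ← count-vertices s | ev′ , od′ ← count-verticesF p
    rewrite neighbour-colour (adjacent T a) | opposite-involutive (colour v) =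
    trans (count-++ _ (vertices T s) (verticesF T p)) (cong₂ _+_ ev ev′) ,
    trans (count-++ _ (vertices T s) (verticesF T p)) (cong₂ _+_ od od′)

  count-partition : ∀ κ us → count κ us + count (opposite κ) us ≡ length us
  count-partition κ []       = refl
  count-partition κ (u ∷ us) with colour u ≟ᶜ κ
  ... | yes u≡κ = trans (cong (suc (count κ us) +_) (count-∷-no us (colour-≢ u≡κ)))
                        (cong suc (count-partition κ us))
  ... | no  u≢κ = trans (cong (count κ us +_) (count-∷-yes us (≢⇒opposite (≢-sym u≢κ))))
                        (trans (+-suc _ _) (cong suc (count-partition κ us)))

  ↝-next : ∀ {v} (a b : Neighbour v) → a ↝[ next v ] b
  ↝-next {v} a b with k , refl ← cyclic v a b = fold-↝ k

  -- The edges at `w` are images of neighbours under `edgeAtWhite w`, which carries steps of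
  -- `next w` to steps of the rotation.
  ↝-white : ∀ (x y : Edge) → proj₁ (value x) ≡ proj₁ (value y) → x ↝[ turnAtWhite next ] y
  ↝-white ((w , b) , [ x ]) ((w , b′) , [ y ]) refl =
    gmap (edgeAtWhite w (proj₁ x)) (cong (edgeAtWhite w (proj₁ x)))
      (↝-next (b , [ proj₂ (proj₂ x) ]) (b′ , [ proj₂ (proj₂ y) ]))

  ↝-black : ∀ (x y : Edge) → proj₂ (value x) ≡ proj₂ (value y) → x ↝[ turnAtBlack next ] y
  ↝-black ((w , b) , [ x ]) ((w′ , b) , [ y ]) refl =
    gmap (edgeAtBlack b (proj₁ (proj₂ x))) (cong (edgeAtBlack b (proj₁ (proj₂ x))))
      (↝-next (w , [ symmetric (proj₂ (proj₂ x)) ]) (w′ , [ symmetric (proj₂ (proj₂ y)) ]))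

  -- Each edge is labelled by its endpoint of colour `κ`. The orbits of `r` are then the vertices of
  -- that colour, and `e` transports this to `Fin m`.
  sgn-rotation : ∀ {m} (e : Enumeration m) (r : Edge ↔ Edge) (κ : Colour) (endpoint : Edge → Fin n) →
                 (∀ x → endpoint (Inverse.to r x) ≡ endpoint x) →
                 (∀ x y → endpoint x ≡ endpoint y → x ↝[ Inverse.to r ] y) →
                 (∀ x → colour (endpoint x) ≡ κ) →
                 (∀ {v} → colour v ≡ κ → ∃[ x ] endpoint x ≡ v) →
                 ∀ {us} → Unique us → (∀ u → u ∈ us) →
                 sgn (↔-sym e ↔-∘ (r ↔-∘ e)) ≡ parity (m + count κ us)
  sgn-rotation e r κ endpoint invariant transitive coloured onto {us} uniq all∈ =
    sgn-orbits (↔-sym e ↔-∘ (r ↔-∘ e)) (endpoint ∘ to e) (ofColour κ us)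
      (λ i → trans (cong endpoint (strictlyInverseˡ e _)) (invariant (to e i)))
      -- The path between the two edges is pulled back along `e`; each step re-enters `Edge` through
      -- `to e ∘ from e`.
      (λ i j eq → subst₂ (_↝[ to (↔-sym e ↔-∘ (r ↔-∘ e)) ]_) (strictlyInverseʳ e i) (strictlyInverseʳ e j)
        (gmap (from e) (λ { refl → cong (from e ∘ to r) (strictlyInverseˡ e _) })
          (transitive (to e i) (to e j) eq)))
      (Unique.filter⁺ (λ u → colour u ≟ᶜ κ) uniq)
      (λ i → ∈-filter⁺ (λ u → colour u ≟ᶜ κ) (all∈ _) (coloured (to e i)))
      (λ {v} v∈ → let x , eq = onto (proj₂ (∈-filter⁻ (λ u → colour u ≟ᶜ κ) {xs = us} v∈)) in
        from e x , trans (cong endpoint (strictlyInverseˡ e x)) eq)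
    where open Inverse

  module _ {root : Fin n} {marked : Neighbour root} {ts : List PRTree}
           (2∣n : 2 ∣ n) (p : Pointwise (SubtreeAt T) (edgesFrom marked) ts) where

    private
      t : PRTree
      t = node ts

      us : List (Fin n)
      us = root ∷ verticesF T p

      count-even : count (colour root) us ≡ evens t
      count-even = trans (count-∷-yes (verticesF T p) refl) (cong suc (proj₂ (count-verticesF p)))

      count-odd : count (opposite (colour root)) us ≡ odds t
      count-odd = trans (count-∷-no (verticesF T p) (colour-≢ refl)) (proj₁ (count-verticesF p))

      size : evens t + odds t ≡ n
      size = trans (sym (cong₂ _+_ count-even count-odd)) (trans (count-partition (colour root) us) (rooted-length T p))

      evens≡odds : parity (evens t) ≡ parity (odds t)
      evens≡odds = ℙ.+-cancelʳ-≡ (parity (odds t)) _ _ (begin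
        parity (evens t) ℙ.+ parity (odds t)  ≡⟨ ℙ.+-homo-+ (evens t) (odds t) ⟨
        parity (evens t + odds t)             ≡⟨ cong parity size ⟩
        parity n                              ≡⟨ parity-even 2∣n ⟩
        0ℙ                                    ≡⟨ ℙ.p+p≡0ℙ (parity (odds t)) ⟨
        parity (odds t) ℙ.+ parity (odds t)   ∎)
        where open ≡-Reasoning

    -- The two colour classes are the vertices at even and at odd depth, and their sizes agree
    -- modulo 2 because `n` is even.
    parity-count : ∀ κ → parity (count κ us) ≡ parity (odds t)
    parity-count κ with κ ≟ᶜ colour root
    ... | yes refl = trans (cong parity count-even) evens≡odds
    ... | no  κ≢ rewrite ≢⇒opposite (≢-sym κ≢) = cong parity count-odd

    parity-odds : parity (odds t) ≡ parity (tri n) ℙ.+ parity (inversions (code t))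
    parity-odds = ℙ.+-cancelˡ-≡ i _ _ (begin
      i ℙ.+ parity (odds t)           ≡⟨ parity-inversions t ⟩
      parity (tri (openings (code t))) ≡⟨ cong (parity ∘ tri) (trans (openings-code t) size) ⟩
      parity (tri n)                  ≡⟨ ℙ.+-identityʳ _ ⟨
      parity (tri n) ℙ.+ 0ℙ           ≡⟨ cong (parity (tri n) ℙ.+_) (ℙ.p+p≡0ℙ i) ⟨
      parity (tri n) ℙ.+ (i ℙ.+ i)    ≡⟨ ℙ.+-assoc (parity (tri n)) i i ⟨
      parity (tri n) ℙ.+ i ℙ.+ i      ≡⟨ ℙ.+-comm _ i ⟩
      i ℙ.+ (parity (tri n) ℙ.+ i)    ∎)
      where
      open ≡-Reasoning
      i : Parity
      i = parity (inversions (code t))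

    module _ {m : ℕ} (e : Enumeration m) where

      parity-cycles : ∀ κ → parity (m + count κ us) ≡ rotationSign m n t
      parity-cycles κ = begin
        parity (m + count κ us)            ≡⟨ ℙ.+-homo-+ m (count κ us) ⟩
        parity m ℙ.+ parity (count κ us)   ≡⟨ cong (parity m ℙ.+_) (trans (parity-count κ) parity-odds) ⟩
        parity m ℙ.+ (parity (tri n) ℙ.+ parity (inversions (code t)))
          ≡⟨ ℙ.+-assoc (parity m) _ _ ⟨
        rotationSign m n t ∎
        where open ≡-Reasoning

      -- Each vertex must carry an edge in order to be counted as an orbit: the root has `marked`,
      -- any other vertex the first edge towards the root.
      someNeighbour : ∀ v → Neighbour v
      someNeighbour v with connected v root
      ... | ε     = marked
      ... | a ◅ _ = _ , [ a ]

      sgn-s-w : sgn (s-w e) ≡ rotationSign m n t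
      sgn-s-w = trans
        (sgn-rotation e rotateAtWhite white (proj₁ ∘ value) (λ _ → refl) ↝-white
          (λ { ((w , b) , [ x ]) → recompute (colour w ≟ᶜ white) (proj₁ x) })
          (λ {v} eq → edgeAtWhite v eq (someNeighbour v) , refl)
          (rooted-unique T p) (rooted-complete T p))
        (parity-cycles white)

      sgn-s-b : sgn (s-b e) ≡ rotationSign m n t
      sgn-s-b = trans
        (sgn-rotation e rotateAtBlack black (proj₂ ∘ value) (λ _ → refl) ↝-black
          (λ { ((w , b) , [ x ]) → recompute (colour b ≟ᶜ black) (proj₁ (proj₂ x)) })
          (λ {v} eq → edgeAtBlack v eq (someNeighbour v) , refl)
          (rooted-unique T p) (rooted-complete T p))
        (parity-cycles black)

-- Signs in generated subgroups

module _ {m : ℕ} {σ τ : Permutation′ m} where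

  sgn-⟨⟩ : sgn σ ≡ 0ℙ → sgn τ ≡ 0ℙ → ∀ {π} → ⟨ σ , τ ⟩ π → sgn π ≡ 0ℙ
  sgn-⟨⟩ σ≡0 τ≡0 fst = σ≡0
  sgn-⟨⟩ σ≡0 τ≡0 snd = τ≡0
  sgn-⟨⟩ σ≡0 τ≡0 unit = sgn-id {m}
  sgn-⟨⟩ σ≡0 τ≡0 (comp {π} {ρ} x y) =
    trans (sgn-∘ π ρ) (cong₂ ℙ._+_ (sgn-⟨⟩ σ≡0 τ≡0 x) (sgn-⟨⟩ σ≡0 τ≡0 y))
  sgn-⟨⟩ σ≡0 τ≡0 (inv {π} x) = trans (sgn-flip π) (sgn-⟨⟩ σ≡0 τ≡0 x)
  sgn-⟨⟩ σ≡0 τ≡0 (resp {π} {ρ} π≈ρ x) = trans (sym (sgn-cong π ρ π≈ρ)) (sgn-⟨⟩ σ≡0 τ≡0 x)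

  odd∉even-group : sgn σ ≡ 0ℙ → sgn τ ≡ 0ℙ → ∀ {π} → sgn π ≡ 1ℙ → ¬ ⟨ σ , τ ⟩ π
  odd∉even-group σ≡0 τ≡0 π≡1 x with () ← trans (sym (sgn-⟨⟩ σ≡0 τ≡0 x)) π≡1

proposition5p1 : (n : ℕ) → 0 < n → 2 ∣ n →
    (T U : PlaneTree n) → EvenPlane T → OddPlane U →
    (B : BipartiteStructure T) (C : BipartiteStructure U) →
    (e : BipartiteStructure.Enumeration B (n ∸ 1)) →
    (f : BipartiteStructure.Enumeration C (n ∸ 1)) →
    ¬ (RotationGroup B e ≐ RotationGroup C f)
proposition5p1 n _ 2∣n T U (_ , _ , t , node p , even) (_ , _ , u , node q , odd) B C e f (R⊆S , S⊆R) =
  -- The shared term decides which group is even. If it is `0ℙ`, the generators for `T` are even and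
  -- `s-w f` is odd; if it is `1ℙ`, those for `U` are even and `s-w e` is odd.
  by-sign (parity (n ∸ 1) ℙ.+ parity (tri n)) refl
  where
  signT : ∀ {c} → parity (n ∸ 1) ℙ.+ parity (tri n) ≡ c → rotationSign (n ∸ 1) n t ≡ c
  signT eq = trans (cong₂ ℙ._+_ eq (parity-even even)) (ℙ.+-identityʳ _)

  signU : ∀ {c} → parity (n ∸ 1) ℙ.+ parity (tri n) ≡ c → rotationSign (n ∸ 1) n u ≡ c ℙ.+ 1ℙ
  signU eq = cong₂ ℙ._+_ eq (parity-odd odd)

  by-sign : ∀ c → parity (n ∸ 1) ℙ.+ parity (tri n) ≡ c → _
  by-sign 0ℙ eq = odd∉even-group (trans (sgn-s-w B 2∣n p e) (signT eq)) (trans (sgn-s-b B 2∣n p e) (signT eq))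
                    (trans (sgn-s-w C 2∣n q f) (signU eq)) (S⊆R fst)
  by-sign 1ℙ eq = odd∉even-group (trans (sgn-s-w C 2∣n q f) (signU eq)) (trans (sgn-s-b C 2∣n q f) (signU eq))
                    (trans (sgn-s-w B 2∣n p e) (signT eq)) (R⊆S fst)
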